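{- The superintuitionistic logic $\mathsf{Cheq}$ does not contain the Kreisel-Putnam axiom $$\mathsf{kp}=(\neg p\rightarrow q\vee r)\rightarrow\bigl((\neg p\rightarrow q)\vee(\neg p\rightarrow r)\bigr),$$ where $p,q,r$ are distinct propositional variables.
   Context: Let $\mathfrak{F}_1=\langle W_1,R_1\rangle$ be the 2-fork: $W_1=\{w_0,w_-,w_+\}$, and $R_1$ is the partial order in which every point is related to itself and, besides that, exactly $w_0R_1w_-$ and $w_0R_1w_+$ hold. For $n\ge 1$, $\mathfrak{F}_n=\langle W_1^n,R_n\rangle$ is the $n$-fold product of $\mathfrak{F}_1$ with the componentwise (product) order: $\bar xR_n\bar y$ iff $x_iR_1y_i$ for all $i\in\{1,\dots,n\}$. Formulas are built from propositional variables with $\wedge,\vee,\rightarrow,\bot$, with $\neg\varphi:=\varphi\rightarrow\bot$, and are interpreted on partially ordered Kripke frames by the standard intuitionistic Kripke semantics (valuations assign upward closed sets to variables). A formula is valid in a frame if it holds at every point under every valuation. $\mathsf{Cheq}$ is the set of all formulas valid in every $\mathfrak{F}_n$, $n\ge1$. -}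

module Defs where

open import Data.Empty using (⊥)
open import Data.Nat.Base using (ℕ; _≤_)
open import Data.Product.Base using (_×_)
open import Data.Sum.Base using (_⊎_)
open import Data.Vec.Base using (Vec; []; _∷_)
open import Data.Vec.Relation.Binary.Pointwise.Inductive as Pointwise
  using (Pointwise; []; _∷_)
open import Level using (0ℓ; suc)
open import Relation.Binary.Bundles using (Poset)
open import Relation.Binary.Definitions
  using (Transitive; Antisymmetric; _Respects_)
open import Relation.Binary.PropositionalEquality
  using (_≡_; refl; cong₂; isEquivalence)
open import Relation.Unary using (Pred)

infix  9 ~_
infixr 7 _∧_
infixr 6 _∨_
infixr 5 _⇒_

data Formula : Set where
  var         : ℕ → Formula
  bot         : Formula
  _∧_ _∨_ _⇒_ : Formula → Formula → Formula

~_ : Formula → Formula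
~ φ = φ ⇒ bot

kp : ℕ → ℕ → ℕ → Formula
kp p q r = (~ var p ⇒ var q ∨ var r) ⇒ ((~ var p ⇒ var q) ∨ (~ var p ⇒ var r))

Frame : Set₁
Frame = Poset 0ℓ 0ℓ 0ℓ

module Kripke (F : Frame) where
  open Poset F using (Carrier) renaming (_≤_ to _⊑_)

  record Valuation : Set₁ where
    field
      ⟦_⟧    : ℕ → Pred Carrier 0ℓ
      upward : ∀ p → ⟦ p ⟧ Respects _⊑_

  infix 4 _,_⊩_

  _,_⊩_ : Valuation → Carrier → Formula → Set
  V , x ⊩ var p = Valuation.⟦_⟧ V p x
  V , x ⊩ bot   = ⊥
  V , x ⊩ φ ∧ ψ = V , x ⊩ φ × V , x ⊩ ψ
  V , x ⊩ φ ∨ ψ = V , x ⊩ φ ⊎ V , x ⊩ ψ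
  V , x ⊩ φ ⇒ ψ = ∀ y → x ⊑ y → V , y ⊩ φ → V , y ⊩ ψ

  Valid : Formula → Set₁
  Valid φ = ∀ V x → V , x ⊩ φ

open Kripke public using (Valid)

data W₁ : Set where
  w₀ w₋ w₊ : W₁

data R₁ : W₁ → W₁ → Set where
  rfl   : ∀ {w} → R₁ w w
  w₀≤w₋ : R₁ w₀ w₋
  w₀≤w₊ : R₁ w₀ w₊

R₁-trans : Transitive R₁
R₁-trans rfl   s   = s
R₁-trans w₀≤w₋ rfl = w₀≤w₋
R₁-trans w₀≤w₊ rfl = w₀≤w₊

R₁-antisym : Antisymmetric _≡_ R₁
R₁-antisym rfl   _  = refl
R₁-antisym w₀≤w₋ ()
R₁-antisym w₀≤w₊ ()

R : (n : ℕ) → Vec W₁ n → Vec W₁ n → Set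
R n xs ys = Pointwise R₁ xs ys

R-antisym : ∀ {n} → Antisymmetric _≡_ (R n)
R-antisym []       []       = refl
R-antisym (r ∷ rs) (s ∷ ss) = cong₂ _∷_ (R₁-antisym r s) (R-antisym rs ss)

𝔉 : ℕ → Frame
𝔉 n = record
  { Carrier        = Vec W₁ n
  ; _≈_            = _≡_
  ; _≤_            = R n
  ; isPartialOrder = record
    { isPreorder = record
      { isEquivalence = isEquivalence
      ; reflexive     = λ { refl → Pointwise.refl rfl }
      ; trans         = Pointwise.trans R₁-trans
      }
    ; antisym = R-antisym
    }
  }

Cheq : Pred Formula (suc 0ℓ)
Cheq φ = ∀ n → 1 ≤ n → Valid (𝔉 n) φ

{-# OPTIONS --safe #-}
-- The formula kp already fails at the root of 𝔉₂, a square whose four vertices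
-- are the maximal points. Let p hold on one diagonal pair of vertices. Every
-- point other than the two vertices of the opposite diagonal lies below p, so
-- ¬p holds exactly at those two; let q hold at one of them and r at the other.
module Submission where

open import Defs
open import Data.Nat.Base using (ℕ; z≤n; s≤s)
open import Data.Sum.Base using (inj₁; inj₂)
open import Data.Vec.Base using (Vec; []; _∷_)
open import Data.Vec.Relation.Binary.Pointwise.Inductive using ([]; _∷_)
open import Relation.Binary.Definitions using (_Respects_)
open import Relation.Binary.PropositionalEquality using (_≢_; refl)
open import Relation.Nullary.Negation using (contradiction)
open import Relation.Unary using (_∉_)

open Kripke (𝔉 2) using (Valuation; _,_⊩_)

pattern ⟨_,_⟩ a b = a ∷ b ∷ []

-- The variable is an index, so no variables need be compared here; if one is true at another's
-- vertex, matching equates the two.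
data Holds (p q r : ℕ) : ℕ → Vec W₁ 2 → Set where
  p₋₊ : Holds p q r p ⟨ w₋ , w₊ ⟩
  p₊₋ : Holds p q r p ⟨ w₊ , w₋ ⟩
  q₋₋ : Holds p q r q ⟨ w₋ , w₋ ⟩
  r₊₊ : Holds p q r r ⟨ w₊ , w₊ ⟩

-- All four vertices are maximal: only the reflexive step leaves them.
Holds-upward : ∀ {p q r} i → Holds p q r i Respects R 2
Holds-upward _ ⟨ rfl , rfl ⟩ h = h
Holds-upward _ ⟨ w₀≤w₋ , _ ⟩ ()
Holds-upward _ ⟨ w₀≤w₊ , _ ⟩ ()
Holds-upward _ ⟨ rfl , w₀≤w₋ ⟩ ()
Holds-upward _ ⟨ rfl , w₀≤w₊ ⟩ ()

module _ {p q r : ℕ} where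

  V : Valuation
  V = record { ⟦_⟧ = Holds p q r ; upward = Holds-upward }

  ~p-at-₋₋ : p ≢ q → V , ⟨ w₋ , w₋ ⟩ ⊩ ~ var p
  ~p-at-₋₋ p≢q _ ⟨ rfl , rfl ⟩ q₋₋ = p≢q refl

  ~p-at-₊₊ : p ≢ r → V , ⟨ w₊ , w₊ ⟩ ⊩ ~ var p
  ~p-at-₊₊ p≢r _ ⟨ rfl , rfl ⟩ r₊₊ = p≢r refl

  ~p⇒q∨r : ∀ x → V , x ⊩ ~ var p → V , x ⊩ var q ∨ var r
  -- Replacing each `w₀` so that the two signs differ reaches a vertex of `p`.
  ~p⇒q∨r ⟨ w₀ , w₀ ⟩ ¬p = contradiction p₋₊ (¬p _ ⟨ w₀≤w₋ , w₀≤w₊ ⟩)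
  ~p⇒q∨r ⟨ w₀ , w₋ ⟩ ¬p = contradiction p₊₋ (¬p _ ⟨ w₀≤w₊ , rfl ⟩)
  ~p⇒q∨r ⟨ w₀ , w₊ ⟩ ¬p = contradiction p₋₊ (¬p _ ⟨ w₀≤w₋ , rfl ⟩)
  ~p⇒q∨r ⟨ w₋ , w₀ ⟩ ¬p = contradiction p₋₊ (¬p _ ⟨ rfl , w₀≤w₊ ⟩)
  ~p⇒q∨r ⟨ w₊ , w₀ ⟩ ¬p = contradiction p₊₋ (¬p _ ⟨ rfl , w₀≤w₋ ⟩)
  ~p⇒q∨r ⟨ w₋ , w₊ ⟩ ¬p = contradiction p₋₊ (¬p _ ⟨ rfl , rfl ⟩)
  ~p⇒q∨r ⟨ w₊ , w₋ ⟩ ¬p = contradiction p₊₋ (¬p _ ⟨ rfl , rfl ⟩)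
  ~p⇒q∨r ⟨ w₋ , w₋ ⟩ _  = inj₁ q₋₋
  ~p⇒q∨r ⟨ w₊ , w₊ ⟩ _  = inj₂ r₊₊

theorem3 : (p q r : ℕ) → p ≢ q → p ≢ r → q ≢ r → kp p q r ∉ Cheq
theorem3 p q r p≢q p≢r q≢r kp∈Cheq
  with kp∈Cheq 2 (s≤s z≤n) (V {p} {q} {r}) ⟨ w₀ , w₀ ⟩
         _ ⟨ rfl , rfl ⟩ (λ x _ → ~p⇒q∨r x)
-- Each disjunct fails at the vertex of the other's conclusion: `q` at the vertex of `r` would force
-- `q ≡ r`, and symmetrically.
... | inj₁ ~p⇒q with ~p⇒q _ ⟨ w₀≤w₊ , w₀≤w₊ ⟩ (~p-at-₊₊ p≢r)
...   | r₊₊ = q≢r refl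
theorem3 p q r p≢q p≢r q≢r kp∈Cheq
    | inj₂ ~p⇒r with ~p⇒r _ ⟨ w₀≤w₋ , w₀≤w₋ ⟩ (~p-at-₋₋ p≢q)
...   | q₋₋ = q≢r refl
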